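{- For all integers $m,n$ with $2\le m\le n$, $\operatorname{rb}([m]\times[n],\, x_1+x_2=x_3)=m+n+1$.
   Context: $[m]\times[n]=\{(i,j)\in\mathbb{Z}^2: 1\le i\le m,\ 1\le j\le n\}$, with componentwise addition. An $r$-coloring of a set $S$ is a function $c:S\to\{1,\dots,r\}$; it is exact if it is surjective. A solution to $x_1+x_2=x_3$ in $[m]\times[n]$ is a triple $\alpha,\beta,\gamma\in[m]\times[n]$ with $\alpha+\beta=\gamma$; it is rainbow (with respect to $c$) if $\alpha,\beta,\gamma$ receive pairwise distinct colors (so solutions with repeated elements are never rainbow). The rainbow number $\operatorname{rb}([m]\times[n],x_1+x_2=x_3)$ is the smallest $r$ such that every exact $r$-coloring of $[m]\times[n]$ contains a rainbow solution to $x_1+x_2=x_3$. -}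

module Defs where

open import Data.Nat using (ℕ; suc; _+_; _≤_; _<_)
open import Data.Fin using (Fin; toℕ)
open import Relation.Nullary using (¬_)
open import Data.Product using (_×_; _,_; Σ; ∃-syntax)
open import Relation.Binary.PropositionalEquality using (_≡_; _≢_)

-- The grid [m] × [n].  An element is a pair (i , j) of Fin m × Fin n,
-- representing the integer point (toℕ i + 1 , toℕ j + 1), so that
-- coordinates range over 1 … m and 1 … n as in the paper.
Grid : ℕ → ℕ → Set
Grid m n = Fin m × Fin n

coords : ∀ {m n} → Grid m n → ℕ × ℕ
coords (i , j) = (suc (toℕ i) , suc (toℕ j))

IsSolution : ∀ {m n} → Grid m n → Grid m n → Grid m n → Set
IsSolution {m} {n} α β γ with coords {m} {n} α | coords {m} {n} β | coords {m} {n} γ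
... | (a₁ , a₂) | (b₁ , b₂) | (g₁ , g₂) = (a₁ + b₁ ≡ g₁) × (a₂ + b₂ ≡ g₂)

Coloring : ℕ → ℕ → ℕ → Set
Coloring m n r = Grid m n → Fin r

Exact : ∀ {m n r} → Coloring m n r → Set
Exact {m} {n} {r} c = (k : Fin r) → ∃[ p ] (c p ≡ k)

RainbowSolution : ∀ {m n r} → Coloring m n r → Set
RainbowSolution {m} {n} c =
  ∃[ α ] ∃[ β ] ∃[ γ ]
    (IsSolution {m} {n} α β γ × c α ≢ c β × c α ≢ c γ × c β ≢ c γ)

RainbowForced : ℕ → ℕ → ℕ → Set
RainbowForced m n r = (c : Coloring m n r) → Exact c → RainbowSolution c

RbEq : ℕ → ℕ → ℕ → Set
RbEq m n k = (1 ≤ k) × RainbowForced m n k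
           × ((r : ℕ) → 1 ≤ r → r < k → Σ (Coloring m n r) λ c → Exact c × ¬ RainbowSolution c)

{-# OPTIONS --safe #-}

-- For the upper bound, in zero-based coordinates, let c be rainbow-free and call a cell w symmetric if c u = c v whenever
-- u + v = w.  A cell that is not symmetric shares its colour with a smaller one, so every colour
-- occurs at a symmetric cell.  Let (g , g) be the last main-diagonal cell below a symmetric cell, let
-- the main colours be those of (t , t) for t ≤ g, and let q be least with c(q , q) ≠ c(0 , 0).  If two
-- cells on a common diagonal have colours that are not main, their difference forces these
-- colours to agree.  There are m + n - 2 diagonals besides the main one; the colours of (0 , 0) and
-- (q , q) bring the bound to m + n.  Any other main colour, first occurring at (t , t) say, has t ≥ q + 2
-- and is charged to a diagonal that is not needed otherwise: with y = t - 2, take the lowest row x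
-- having a symmetric cell w to the right of column y.  If (x , y) and (x , y + 1) are both symmetric, then
-- c(q-1 , q-1) = c(q-1 , q); were the same to happen for columns, c(q-1 , q) = c(q , q), a contradiction.
-- So up to transposition one of these two cells is not symmetric, and then reflection in w moves
-- any colour on its diagonal to a diagonal on the other side of the main one.  First occurrences
-- are never adjacent, so distinct main colours are charged to distinct diagonals.
module Submission where

open import Defs
open import Data.Nat using (ℕ; zero; suc; _+_; _∸_; _≤_; _<_; z≤n; s≤s; s≤s⁻¹; _≟_; _<?_)
open import Data.Nat.Properties
open import Data.Nat.Solver using (module +-*-Solver)
open import Data.Fin using (Fin; toℕ; fromℕ<)
import Data.Fin.Properties as Fin
open import Data.Product using (_×_; _,_; ∃-syntax; proj₁; proj₂)
open import Data.Sum using (_⊎_; inj₁; inj₂; [_,_]′)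
open import Function using (_∘_)
open import Relation.Binary using (tri<; tri≈; tri>)
open import Relation.Binary.PropositionalEquality
open import Relation.Nullary using (¬_; Dec; yes; no; ¬?; contradiction)
open import Relation.Nullary.Decidable using (_×-dec_; decidable-stable; map′)
open import Relation.Unary using (Decidable)

open +-*-Solver using (solve; _:+_; _:=_; con)

-- Bounded search for decidable predicates.

greatest : ∀ {P : ℕ → Set} → Decidable P → ∀ n k → k ≤ n → P k →
           ∃[ x ] (x ≤ n × P x × (∀ y → y ≤ n → P y → y ≤ x))
greatest P? zero zero z≤n Pk = 0 , z≤n , Pk , λ _ y≤0 _ → y≤0
greatest {P} P? (suc n) k k≤n Pk with P? (suc n)
... | yes Pn = suc n , ≤-refl , Pn , λ _ y≤n _ → y≤n
... | no ¬Pn with greatest P? n k (below k≤n Pk) Pk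
  where
  below : ∀ {y} → y ≤ suc n → P y → y ≤ n
  below y≤n Py with m≤n⇒m<n∨m≡n y≤n
  ... | inj₁ y<n = s≤s⁻¹ y<n
  ... | inj₂ refl = contradiction Py ¬Pn
... | x , x≤n , Px , max = x , m≤n⇒m≤1+n x≤n , Px , max′
  where
  max′ : ∀ y → y ≤ suc n → P y → y ≤ x
  max′ y y≤n Py with m≤n⇒m<n∨m≡n y≤n
  ... | inj₁ y<n = max y (s≤s⁻¹ y<n) Py
  ... | inj₂ refl = contradiction Py ¬Pn

leastBelow : ∀ {P : ℕ → Set} → Decidable P → ∀ n →
             (∃[ x ] (x < n × P x × (∀ y → y < x → ¬ P y))) ⊎ (∀ x → x < n → ¬ P x)
leastBelow P? zero = inj₂ λ _ ()
leastBelow {P} P? (suc n) with leastBelow P? n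
... | inj₁ (x , x<n , Px , min) = inj₁ (x , m≤n⇒m≤1+n x<n , Px , min)
... | inj₂ none with P? n
...   | yes Pn = inj₁ (n , ≤-refl , Pn , none)
...   | no ¬Pn = inj₂ none′
  where
  none′ : ∀ x → x < suc n → ¬ P x
  none′ x x<1+n Px with m<1+n⇒m<n∨m≡n x<1+n
  ... | inj₁ x<n = none x x<n Px
  ... | inj₂ refl = ¬Pn Px

allBelow⊎ : ∀ {A : ℕ → Set} {B : Set} n → (∀ x → x < n → A x ⊎ B) → (∀ x → x < n → A x) ⊎ B
allBelow⊎ zero f = inj₁ λ _ ()
allBelow⊎ {A} (suc n) f with allBelow⊎ n (λ x x<n → f x (m≤n⇒m≤1+n x<n)) | f n ≤-refl
... | inj₂ b | _ = inj₂ b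
... | inj₁ _ | inj₂ b = inj₂ b
... | inj₁ all | inj₁ a = inj₁ all′
  where
  all′ : ∀ x → x < suc n → A x
  all′ x x<1+n with m<1+n⇒m<n∨m≡n x<1+n
  ... | inj₁ x<n = all x x<n
  ... | inj₂ refl = a

-- Symmetric cells carry every colour.

-- Cells are pairs of zero-based coordinates, so that the sum of the cells (a , b) and
-- (a′ , b′) is the cell (suc (a + a′) , suc (b + b′)).  M and N are the last indices.
Symmetric : ∀ {r} → (ℕ → ℕ → Fin r) → ℕ → ℕ → Set
Symmetric c x y = ∀ a a′ b b′ → suc (a + a′) ≡ x → suc (b + b′) ≡ y → c a b ≡ c a′ b′

RainbowFree : ∀ {r} → ℕ → ℕ → (ℕ → ℕ → Fin r) → Set
RainbowFree M N c = ∀ a a′ b b′ → suc (a + a′) ≤ M → suc (b + b′) ≤ N →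
  c a b ≡ c a′ b′ ⊎ c a b ≡ c (suc (a + a′)) (suc (b + b′)) ⊎ c a′ b′ ≡ c (suc (a + a′)) (suc (b + b′))

below⇒sum : ∀ {a x} → a < x → ∃[ a′ ] suc (a + a′) ≡ x
below⇒sum a<x = m≤n⇒∃[o]m+o≡n a<x

symmetric⊎ : ∀ {r} (c : ℕ → ℕ → Fin r) x y → Symmetric c x y ⊎
  ∃[ a ] ∃[ a′ ] ∃[ b ] ∃[ b′ ] (suc (a + a′) ≡ x × suc (b + b′) ≡ y × c a b ≢ c a′ b′)
symmetric⊎ c x y
  with anyUpTo? (λ a → anyUpTo? (λ b → ¬? (c a b Fin.≟ c (x ∸ suc a) (y ∸ suc b))) y) x
... | yes (a , a<x , b , b<y , ne) =
  inj₂ (a , x ∸ suc a , b , y ∸ suc b , m+[n∸m]≡n a<x , m+[n∸m]≡n b<y , ne)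
... | no none = inj₁ reflect
  where
  reflect : Symmetric c x y
  reflect a a′ b b′ refl refl with c a b Fin.≟ c a′ b′
  ... | yes eq = eq
  ... | no ne = contradiction
    (a , s≤s (m≤m+n a a′) , b , s≤s (m≤m+n b b′) ,
      subst₂ (λ u v → c a b ≢ c u v) (sym (m+n∸m≡n a a′)) (sym (m+n∸m≡n b b′)) ne)
    none

symmetric? : ∀ {r} (c : ℕ → ℕ → Fin r) x y → Dec (Symmetric c x y)
symmetric? c x y with symmetric⊎ c x y
... | inj₁ s = yes s
... | inj₂ (a , a′ , b , b′ , p , p′ , ne) = no λ s → ne (s a a′ b b′ p p′)

-- If two summands differ in colour, the cell shares its colour with one of them, whose row is
-- smaller; so descent on the row ends at a symmetric cell.
symmetricCell : ∀ {r M N} (c : ℕ → ℕ → Fin r) → RainbowFree M N c → ∀ a b → a ≤ M → b ≤ N →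
                ∃[ x ] ∃[ y ] (x ≤ M × y ≤ N × Symmetric c x y × c x y ≡ c a b)
symmetricCell {r} {M} {N} c rf a₀ b₀ = descend (suc a₀) a₀ b₀ ≤-refl
  where
  descend : ∀ n a b → a < n → a ≤ M → b ≤ N →
            ∃[ x ] ∃[ y ] (x ≤ M × y ≤ N × Symmetric c x y × c x y ≡ c a b)
  descend (suc n) a b a<n a≤M b≤N with symmetric⊎ c a b
  ... | inj₁ s = a , b , a≤M , b≤N , s , refl
  ... | inj₂ (u , u′ , v , v′ , refl , refl , ne) with rf u u′ v v′ a≤M b≤N
  ...   | inj₁ eq = contradiction eq ne
  ...   | inj₂ (inj₁ eq)
    with x , y , p , q , s , e ← descend n u v (<-≤-trans (s≤s (m≤m+n u u′)) (s≤s⁻¹ a<n))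
                                   (≤-trans (m≤n⇒m≤1+n (m≤m+n u u′)) a≤M)
                                   (≤-trans (m≤n⇒m≤1+n (m≤m+n v v′)) b≤N)
    = x , y , p , q , s , trans e eq
  ...   | inj₂ (inj₂ eq)
    with x , y , p , q , s , e ← descend n u′ v′ (<-≤-trans (s≤s (m≤n+m u′ u)) (s≤s⁻¹ a<n))
                                   (≤-trans (m≤n⇒m≤1+n (m≤n+m u′ u)) a≤M)
                                   (≤-trans (m≤n⇒m≤1+n (m≤n+m v′ v)) b≤N)
    = x , y , p , q , s , trans e eq

-- Cells below symmetric ones, and bad rows.

Below : ∀ {r} → ℕ → ℕ → (ℕ → ℕ → Fin r) → ℕ → ℕ → Set
Below M N c a b = ∃[ x ] ∃[ y ] (x ≤ M × y ≤ N × Symmetric c x y × a ≤ x × b ≤ y)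

-- Row `row` is the lowest one with a symmetric cell to the right of column y; by `lowest`
-- all symmetric cells on the diagonal of (row , col) lie strictly above that cell.
record BadRow {r} (M N : ℕ) (c : ℕ → ℕ → Fin r) (y : ℕ) : Set where
  field
    row col end : ℕ
    row≤M : row ≤ M
    end≤N : end ≤ N
    y<end : y < end
    symmetricEnd : Symmetric c row end
    lowest : ∀ x z → x ≤ M → z ≤ N → Symmetric c x z → y < z → x ≤ row
    y≤col : y ≤ col
    col≤1+y : col ≤ suc y
    asymmetric : ¬ Symmetric c row col

sameDiagonal : ∀ {k a b a′ b′} M → k + a ≡ b + M → k + a′ ≡ b′ + M → a + b′ ≡ b + a′
sameDiagonal {k} {a} {b} {a′} {b′} M p p′ = +-cancelʳ-≡ M (a + b′) (b + a′) (begin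
  a + b′ + M    ≡⟨ +-assoc a b′ M ⟩
  a + (b′ + M)  ≡⟨ cong (a +_) (sym p′) ⟩
  a + (k + a′)  ≡⟨ solve 3 (λ a k a′ → a :+ (k :+ a′) := (k :+ a) :+ a′) refl a k a′ ⟩
  k + a + a′    ≡⟨ cong (_+ a′) p ⟩
  b + M + a′    ≡⟨ solve 3 (λ b M a′ → b :+ M :+ a′ := b :+ a′ :+ M) refl b M a′ ⟩
  b + a′ + M    ∎)
  where open ≡-Reasoning

sameDiagonal-step : ∀ {a b b′} t → a + b′ ≡ b + suc (a + t) → b′ ≡ suc (b + t)
sameDiagonal-step {a} {b} {b′} t eq = +-cancelˡ-≡ a b′ (suc (b + t)) (trans eq
  (solve 3 (λ a b t → b :+ (con 1 :+ (a :+ t)) := a :+ (con 1 :+ (b :+ t))) refl a b t))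

-- Charging colours to diagonals.

module Slots {r} (M N : ℕ) (c : ℕ → ℕ → Fin r) (rf : RainbowFree M N c) (g q : ℕ)
  (corner : Below M N c g g)
  (g-max : ∀ t → Below M N c t t → t ≤ g)
  (flat : ∀ t → t < q → c t t ≡ c 0 0)
  (pivot : q ≤ g → c q q ≢ c 0 0)
  (bad : ∀ y → q ≤ y → 2 + y ≤ g → BadRow M N c y)
  where

  open BadRow

  g≤M : g ≤ M
  g≤M = let _ , _ , x≤M , _ , _ , g≤x , _ = corner in ≤-trans g≤x x≤M

  g≤N : g ≤ N
  g≤N = let _ , _ , _ , y≤N , _ , _ , g≤y = corner in ≤-trans g≤y y≤N

  -- The symmetric cell behind `corner` lies to the right of column `y`, so `lowest` applies to it.
  row≥g : ∀ {y} → 2 + y ≤ g → (β : BadRow M N c y) → g ≤ row β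
  row≥g y<g β =
    let x , z , x≤M , z≤N , s , g≤x , g≤z = corner in
    ≤-trans g≤x (lowest β x z x≤M z≤N s (≤-trans (m≤n⇒m≤1+n ≤-refl) (≤-trans y<g g≤z)))

  col<row : ∀ {y} → 2 + y ≤ g → (β : BadRow M N c y) → col β < row β
  col<row y<g β = ≤-trans (s≤s (col≤1+y β)) (≤-trans y<g (row≥g y<g β))

  First : ℕ → Set
  First t = ∀ s → s < t → c s s ≢ c t t

  -- The sum of `(0 , 0)` and `(t , t)` is `(suc t , suc t)`, and a new colour there would make this
  -- solution rainbow.
  first-isolated : ∀ t → 0 < t → suc t ≤ g → c t t ≢ c 0 0 → ¬ First (suc t)
  first-isolated t 0<t t<g ne first with rf 0 t 0 t (≤-trans t<g g≤M) (≤-trans t<g g≤N)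
  ... | inj₁ eq = ne (sym eq)
  ... | inj₂ (inj₁ eq) = first 0 (s≤s z≤n) eq
  ... | inj₂ (inj₂ eq) = first t ≤-refl eq

  -- Diagonals are numbered by `k = b - a + M`, from `0` to `N + M`, the main one being `M`;
  -- `suc (N + M)` is a spare number. `off` avoids all bad diagonals, leaving them to `later`.
  data Slot (R : Fin r) (k : ℕ) : Set where
    origin : R ≡ c 0 0 → k ≡ M → Slot R k
    second : R ≡ c q q → k ≡ suc (N + M) → Slot R k
    later  : ∀ y (q≤y : q ≤ y) (y<g : 2 + y ≤ g) → R ≡ c (2 + y) (2 + y) → First (2 + y) →
             k + row (bad y q≤y y<g) ≡ col (bad y q≤y y<g) + M → Slot R k
    off    : ∀ a b → (∀ t → t ≤ g → c t t ≢ R) → R ≡ c a b → Below M N c a b →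
             (∀ y (q≤y : q ≤ y) (y<g : 2 + y ≤ g) →
               a + col (bad y q≤y y<g) ≢ b + row (bad y q≤y y<g)) →
             k + a ≡ b + M → Slot R k

  index : ∀ a b → a ≤ M → b ≤ N → ∃[ k ] (k < 2 + (N + M) × k + a ≡ b + M)
  index a b a≤M b≤N = b + (M ∸ a) ,
    ≤-trans (s≤s (+-mono-≤ b≤N (m∸n≤m M a))) (n≤1+n _) ,
    trans (+-assoc b (M ∸ a) a) (cong (b +_) (m∸n+n≡m a≤M))

  -- The difference of the two cells is some `(t , t)` below the same symmetric cell, so `t ≤ g`.
  -- Its main colour differs from both `R` and `R′`, and only their equality avoids a rainbow
  -- solution.
  off-unique : ∀ {R R′} a a′ b b′ → (∀ t → t ≤ g → c t t ≢ R) → (∀ t → t ≤ g → c t t ≢ R′) →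
               R ≡ c a b → R′ ≡ c a′ b′ → Below M N c a′ b′ → a + b′ ≡ b + a′ → a < a′ → R ≡ R′
  off-unique a a′ b b′ R-off R′-off refl refl β@(x , y , x≤M , y≤N , s , a′≤x , b′≤y) d a<a′
    with below⇒sum a<a′
  ... | t , refl with sameDiagonal-step {a} {b} {b′} t d
  ...   | refl = [ (λ eq → contradiction (sym eq) (R-off t t≤g))
                 , [ (λ eq → eq) , (λ eq → contradiction eq (R′-off t t≤g)) ]′ ]′
                 (rf a t b t (≤-trans a′≤x x≤M) (≤-trans b′≤y y≤N))
    where
    t≤g : t ≤ g
    t≤g = g-max t (x , y , x≤M , y≤N , s ,
      ≤-trans (m≤n⇒m≤1+n (m≤n+m t a)) a′≤x , ≤-trans (m≤n⇒m≤1+n (m≤n+m t b)) b′≤y)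

  -- Adjacent first occurrences are excluded by `first-isolated`. Otherwise the bad column strictly
  -- increases, while the row cannot: symmetric cells to the right of `y′` are also to the right of
  -- `y`.
  later-unique : ∀ {k} y y′ (q≤y : q ≤ y) (y<g : 2 + y ≤ g) (q≤y′ : q ≤ y′) (y′<g : 2 + y′ ≤ g) →
                 First (2 + y) → First (2 + y′) →
                 k + row (bad y q≤y y<g) ≡ col (bad y q≤y y<g) + M →
                 k + row (bad y′ q≤y′ y′<g) ≡ col (bad y′ q≤y′ y′<g) + M → ¬ y < y′
  later-unique y y′ q≤y y<g q≤y′ y′<g first first′ d d′ y<y′ with m≤n⇒m<n∨m≡n y<y′
  ... | inj₂ refl = first-isolated (2 + y) (s≤s z≤n) y′<g (λ eq → first 0 (s≤s z≤n) (sym eq)) first′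
  ... | inj₁ 1+y<y′ = <-irrefl (sym (sameDiagonal M d d′)) (begin-strict
    col β + row β′  <⟨ +-monoˡ-< (row β′) col<col ⟩
    col β′ + row β′ ≤⟨ +-monoʳ-≤ (col β′) row≥row ⟩
    col β′ + row β  ≡⟨ +-comm (col β′) (row β) ⟩
    row β + col β′  ∎)
    where
    open ≤-Reasoning
    β = bad y q≤y y<g
    β′ = bad y′ q≤y′ y′<g
    col<col : col β < col β′
    col<col = ≤-trans (s≤s (col≤1+y β)) (≤-trans 1+y<y′ (y≤col β′))
    row≥row : row β′ ≤ row β
    row≥row = lowest β (row β′) (end β′) (row≤M β′) (end≤N β′) (symmetricEnd β′)
      (<-trans y<y′ (y<end β′))

  later<M : ∀ {k y} (y<g : 2 + y ≤ g) (β : BadRow M N c y) →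
                  k + row β ≡ col β + M → k < M
  later<M {k} y<g β d = ≰⇒> λ M≤k → <-irrefl (sym d) (begin-strict
    col β + M ≡⟨ +-comm (col β) M ⟩
    M + col β <⟨ +-mono-≤-< M≤k (col<row y<g β) ⟩
    k + row β ∎)
    where open ≤-Reasoning

  off≢origin : ∀ {R a b} → (∀ t → t ≤ g → c t t ≢ R) → R ≡ c a b → Below M N c a b → M + a ≢ b + M
  off≢origin {a = a} {b} R-off refl (x , y , x≤M , y≤N , s , a≤x , b≤y) d
    with refl ← +-cancelˡ-≡ M a b (trans d (+-comm b M)) =
    R-off a (g-max a (x , y , x≤M , y≤N , s , a≤x , b≤y)) refl

  off≢second : ∀ {a b} → Below M N c a b → suc (N + M) + a ≢ b + M
  off≢second {a} {b} (x , y , x≤M , y≤N , s , a≤x , b≤y) d = <-irrefl (sym d) (begin-strict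
    b + M           ≤⟨ +-monoˡ-≤ M (≤-trans b≤y y≤N) ⟩
    N + M           <⟨ ≤-refl ⟩
    suc (N + M)     ≤⟨ m≤m+n _ a ⟩
    suc (N + M) + a ∎)
    where open ≤-Reasoning

  M<last : M < suc (N + M)
  M<last = s≤s (m≤n+m M N)

  origin-unique : ∀ {R} → Slot R M → R ≡ c 0 0
  origin-unique (origin e _) = e
  origin-unique (second _ eq) = contradiction eq (<⇒≢ M<last)
  origin-unique (later _ _ y<g _ _ d) = contradiction (later<M y<g (bad _ _ y<g) d) (<-irrefl refl)
  origin-unique (off a b R-off e β _ d) = contradiction d (off≢origin R-off e β)

  second-unique : ∀ {R} → Slot R (suc (N + M)) → R ≡ c q q
  second-unique (origin _ eq) = contradiction (sym eq) (<⇒≢ M<last)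
  second-unique (second e _) = e
  second-unique (later _ _ y<g _ _ d) = contradiction (later<M y<g (bad _ _ y<g) d) (<⇒≯ M<last)
  second-unique (off _ _ _ _ β _ d) = contradiction d (off≢second β)

  slot-injective : ∀ {R R′ k} → Slot R k → Slot R′ k → R ≡ R′
  slot-injective (origin e refl) σ = trans e (sym (origin-unique σ))
  slot-injective (second e refl) σ = trans e (sym (second-unique σ))
  slot-injective σ (origin e refl) = trans (origin-unique σ) (sym e)
  slot-injective σ (second e refl) = trans (second-unique σ) (sym e)
  slot-injective (later y q≤y y<g e first d) (later y′ q≤y′ y′<g e′ first′ d′) with <-cmp y y′
  ... | tri< y<y′ _ _ = contradiction y<y′ (later-unique y y′ q≤y y<g q≤y′ y′<g first first′ d d′)
  ... | tri≈ _ refl _ = trans e (sym e′)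
  ... | tri> _ _ y>y′ = contradiction y>y′ (later-unique y′ y q≤y′ y′<g q≤y y<g first′ first d′ d)
  slot-injective (later y q≤y y<g _ _ d) (off _ _ _ _ _ free d′) =
    contradiction (sameDiagonal M d′ d) (free y q≤y y<g)
  slot-injective (off _ _ _ _ _ free d) (later y q≤y y<g _ _ d′) =
    contradiction (sameDiagonal M d d′) (free y q≤y y<g)
  slot-injective (off a b R-off e β _ d) (off a′ b′ R′-off e′ β′ _ d′) with <-cmp a a′
  ... | tri< a<a′ _ _ = off-unique a a′ b b′ R-off R′-off e e′ β′ (sameDiagonal M d d′) a<a′
  ... | tri≈ _ refl _ = trans e (trans (cong (c a) b≡b′) (sym e′))
    where
    b≡b′ : b ≡ b′
    b≡b′ = sym (+-cancelˡ-≡ a b′ b (trans (sameDiagonal M d d′) (+-comm b a)))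
  ... | tri> _ _ a>a′ = sym (off-unique a′ a b′ b R′-off R-off e′ e β (sameDiagonal M d′ d) a>a′)

  Hit : ℕ → ℕ → ℕ → Set
  Hit a b y = ∃[ q≤y ] ∃[ y<g ] a + col (bad y q≤y y<g) ≡ b + row (bad y q≤y y<g)

  hit? : ∀ a b → Decidable (Hit a b)
  hit? a b y with q ≤? y | 2 + y ≤? g
  ... | no q≰y | _ = no (q≰y ∘ proj₁)
  ... | yes _ | no y≮g = no (y≮g ∘ proj₁ ∘ proj₂)
  ... | yes q≤y | yes y<g with a + col (bad y q≤y y<g) ≟ b + row (bad y q≤y y<g)
  ...   | yes e = yes (q≤y , y<g , e)
  ...   | no ne = no λ (q≤y′ , y<g′ , e) → ne (subst₂
    (λ u v → a + col (bad y u v) ≡ b + row (bad y u v))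
    (≤-irrelevant q≤y′ q≤y) (≤-irrelevant y<g′ y<g) e)

  HasSlot : Fin r → Set
  HasSlot R = ∃[ k ] (k < 2 + (N + M) × Slot R k)

  -- The reflection of a cell on a bad diagonal lies above the main diagonal, where no diagonal is bad.
  slot-reflected : ∀ a b y → a ≤ M → b ≤ N → Symmetric c a b → (∀ t → t ≤ g → c t t ≢ c a b) →
                   Hit a b y → HasSlot (c a b)
  slot-reflected a b y a≤M b≤N s off-main (q≤y , y<g , e) with bad y q≤y y<g
  ... | β with <-cmp a (row β)
  ...   | tri≈ _ refl _ = contradiction
    (subst (Symmetric c a) (+-cancelˡ-≡ a b (col β) (trans (+-comm a b) (sym e))) s)
    (asymmetric β)
  -- Further down this diagonal, `(a , b)` would be a symmetric cell to the right of column `y`,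
  -- against `lowest`.
  ...   | tri> _ _ a>row with t , refl ← below⇒sum a>row =
    contradiction a>row (≤⇒≯ (lowest β a b a≤M b≤N s
      (≤-trans (s≤s (≤-trans (y≤col β) (m≤m+n _ t)))
        (≤-reflexive (sym (sameDiagonal-step {row β} {col β} {b} t
          (trans (+-comm (row β) b) (trans (sym e) (+-comm _ (col β))))))))))
  ...   | tri< a<row _ _ with t , p ← below⇒sum a<row =
    let
      col≡ : col β ≡ suc (b + t)
      col≡ = sameDiagonal-step {a} {b} {col β} t (trans e (cong (b +_) (sym p)))
      -- Since `col ≤ suc y ≤ end`, this puts the bad cell strictly to the left of the symmetric
      -- one.
      col≢end : col β ≢ end β
      col≢end = λ eq → asymmetric β (subst (Symmetric c (row β)) (sym eq) (symmetricEnd β))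
      d , q′ = below⇒sum (≤∧≢⇒< (≤-trans (col≤1+y β) (y<end β)) col≢end)
      end≡ : suc (b + suc (t + d)) ≡ end β
      end≡ = trans (cong suc (trans (+-suc b (t + d)) (cong suc (sym (+-assoc b t d)))))
               (trans (cong (λ u → suc (u + d)) (sym col≡)) q′)
      t≤row : t ≤ row β
      t≤row = ≤-trans (m≤n⇒m≤1+n (m≤n+m t a)) (≤-reflexive p)
      t≤end : suc (t + d) ≤ end β
      t≤end = ≤-trans (m≤n⇒m≤1+n (m≤n+m (suc (t + d)) b)) (≤-reflexive end≡)
      k , k< , k≡ = index t (suc (t + d)) (≤-trans t≤row (row≤M β)) (≤-trans t≤end (end≤N β))
    in k , k< , off t (suc (t + d)) off-main (symmetricEnd β a t b (suc (t + d)) p end≡)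
         (row β , end β , row≤M β , end≤N β , symmetricEnd β , t≤row , t≤end)
         (λ y′ q≤y′ y′<g → <⇒≢ (+-mono-≤-< (m≤n⇒m≤1+n (m≤m+n t d)) (col<row y′<g (bad y′ q≤y′ y′<g))))
         k≡

  slot-diagonal : ∀ t → t ≤ g → First t → HasSlot (c t t)
  slot-diagonal zero _ _ = M , m≤n⇒m≤1+n M<last , origin refl refl
  slot-diagonal (suc t) t≤g first with <-cmp (suc t) q
  ... | tri< t<q _ _ = contradiction (sym (flat (suc t) t<q)) (first 0 (s≤s z≤n))
  ... | tri≈ _ refl _ = suc (N + M) , ≤-refl , second refl refl
  ... | tri> _ _ (s≤s q≤t) with m≤n⇒m<n∨m≡n q≤t
  -- The index is `suc q`, just after the first change of colour.
  ...   | inj₂ refl = contradiction first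
    (first-isolated q (n≢0⇒n>0 λ { refl → q≢0 refl }) t≤g q≢0)
    where
    q≢0 : c q q ≢ c 0 0
    q≢0 = pivot (≤-trans q≤t (≤-trans (n≤1+n t) t≤g))
  ...   | inj₁ (s≤s {n = y} q≤y) =
    let
      β = bad y q≤y t≤g
      k , k< , k≡ = index (row β) (col β) (row≤M β)
        (≤-trans (col≤1+y β) (≤-trans (n≤1+n _) (≤-trans t≤g g≤N)))
    in k , k< , later y q≤y t≤g refl first k≡

  -- A main colour is moved to its first occurrence on the main diagonal. Any other keeps its own
  -- diagonal unless that one is bad, and is then reflected.
  slot : ∀ a b → a ≤ M → b ≤ N → Symmetric c a b → HasSlot (c a b)
  slot a b a≤M b≤N s with leastBelow (λ t → c t t Fin.≟ c a b) (suc g)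
  ... | inj₁ (t , s≤s t≤g , e , least) = subst HasSlot e
    (slot-diagonal t t≤g λ u u<t eq → least u u<t (trans eq e))
  ... | inj₂ none with anyUpTo? (hit? a b) g
  ...   | yes (y , _ , h) = slot-reflected a b y a≤M b≤N s (λ t t≤g → none t (s≤s t≤g)) h
  ...   | no ¬h = let k , k< , k≡ = index a b a≤M b≤N in
    k , k< , off a b (λ t t≤g → none t (s≤s t≤g)) refl (a , b , a≤M , b≤N , s , ≤-refl , ≤-refl)
      (λ y q≤y y<g e → ¬h (y , ≤-trans (n≤1+n _) y<g , q≤y , y<g , e)) k≡

  fewColours : (∀ k → ∃[ a ] ∃[ b ] (a ≤ M × b ≤ N × c a b ≡ k)) → r ≤ 2 + (N + M)
  fewColours exact = ≮⇒≥ λ many →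
    let i , j , i<j , same = Fin.pigeonhole many λ k → fromℕ< (proj₁ (proj₂ (place k)))
        same′ = trans (sym (Fin.toℕ-fromℕ< _)) (trans (cong toℕ same) (Fin.toℕ-fromℕ< _))
    in Fin.<⇒≢ i<j (slot-injective (proj₂ (proj₂ (place i)))
         (subst (Slot j) (sym same′) (proj₂ (proj₂ (place j)))))
    where
    place : ∀ k → HasSlot k
    place k with a , b , a≤M , b≤N , refl ← exact k
      with x , y , x≤M , y≤N , s , e ← symmetricCell c rf a b a≤M b≤N =
      subst HasSlot e (slot x y x≤M y≤N s)

-- Even rows and even columns.

EvenRow : ∀ {r} → ℕ → ℕ → (ℕ → ℕ → Fin r) → Set
EvenRow g q c = ∃[ x ] ∃[ y ] (q ≤ y × 2 + y ≤ g × g ≤ x × Symmetric c x y × Symmetric c x (suc y))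

-- In the lowest row with a symmetric cell to the right of column `y`, either `y` or `suc y` gives
-- an asymmetric cell, or both are symmetric. The corner cell shows that this row exists and is at
-- least `g`.
badOrEven : ∀ {r} {M N : ℕ} {c : ℕ → ℕ → Fin r} {g} q y → Below M N c g g → q ≤ y → 2 + y ≤ g →
            BadRow M N c y ⊎ EvenRow g q c
badOrEven {M = M} {N} {c} {g} q y (x₀ , z₀ , x₀≤M , z₀≤N , s₀ , g≤x₀ , g≤z₀) q≤y y<g
  with greatest (λ x → anyUpTo? (λ z → (y <? z) ×-dec symmetric? c x z) (suc N)) M x₀ x₀≤M
         (z₀ , s≤s z₀≤N , ≤-trans (n≤1+n _) (≤-trans y<g g≤z₀) , s₀)
... | x , x≤M , (z , z<1+N , y<z , s) , max = choose (symmetric? c x y) (symmetric? c x (suc y))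
  where
  lowest : ∀ x′ z′ → x′ ≤ M → z′ ≤ N → Symmetric c x′ z′ → y < z′ → x′ ≤ x
  lowest x′ z′ x′≤M z′≤N s′ y<z′ = max x′ x′≤M (z′ , s≤s z′≤N , y<z′ , s′)
  badAt : ∀ w → y ≤ w → w ≤ suc y → ¬ Symmetric c x w → BadRow M N c y
  badAt w y≤w w≤1+y ¬s = record
    { row = x ; col = w ; end = z ; row≤M = x≤M ; end≤N = s≤s⁻¹ z<1+N ; y<end = y<z
    ; symmetricEnd = s ; lowest = lowest ; y≤col = y≤w ; col≤1+y = w≤1+y ; asymmetric = ¬s }
  choose : Dec (Symmetric c x y) → Dec (Symmetric c x (suc y)) → BadRow M N c y ⊎ EvenRow g q c
  choose (no ¬s) _ = inj₁ (badAt y ≤-refl (n≤1+n y) ¬s)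
  choose (yes _) (no ¬s) = inj₁ (badAt (suc y) (n≤1+n y) ≤-refl ¬s)
  choose (yes s₁) (yes s₂) = inj₂ (x , y , q≤y , y<g , ≤-trans g≤x₀ (max x₀ x₀≤M
    (z₀ , s≤s z₀≤N , ≤-trans (n≤1+n _) (≤-trans y<g g≤z₀) , s₀)) , s₁ , s₂)

fewOrEven : ∀ {r} {M N : ℕ} {c : ℕ → ℕ → Fin r} → RainbowFree M N c → ∀ g q → Below M N c g g →
            (∀ t → Below M N c t t → t ≤ g) → (∀ t → t < q → c t t ≡ c 0 0) →
            (q ≤ g → c q q ≢ c 0 0) → (∀ k → ∃[ a ] ∃[ b ] (a ≤ M × b ≤ N × c a b ≡ k)) →
            r ≤ 2 + (N + M) ⊎ EvenRow g q c
fewOrEven {M = M} {N} {c} rf g q corner g-max flat pivot exact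
  with allBelow⊎ {A = λ y → q ≤ y → 2 + y ≤ g → BadRow M N c y} g dichotomy
  where
  dichotomy : ∀ y → y < g → (q ≤ y → 2 + y ≤ g → BadRow M N c y) ⊎ EvenRow g q c
  dichotomy y _ with q ≤? y | 2 + y ≤? g
  ... | no q≰y | _ = inj₁ λ q≤y → contradiction q≤y q≰y
  ... | yes _ | no y≮g = inj₁ λ _ y<g → contradiction y<g y≮g
  ... | yes q≤y | yes y<g = [ (λ β → inj₁ λ _ _ → β) , inj₂ ]′ (badOrEven q y corner q≤y y<g)
... | inj₂ even = inj₂ even
... | inj₁ bad = inj₁ (Slots.fewColours M N c rf g q corner g-max flat pivot
  (λ y q≤y y<g → bad y (≤-trans (n≤1+n _) y<g) q≤y y<g) exact)

transpose : ∀ {r} → (ℕ → ℕ → Fin r) → ℕ → ℕ → Fin r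
transpose c a b = c b a

-- The even row carries the colour of (q-1 , q-1) to (q-1 , q), and the even column carries it on to (q , q).
evenRow-evenColumn : ∀ {r} {c : ℕ → ℕ → Fin r} {g} q → (∀ t → t < q → c t t ≡ c 0 0) →
                     (q ≤ g → c q q ≢ c 0 0) → EvenRow g q c → ¬ EvenRow g q (transpose c)
evenRow-evenColumn zero _ pivot _ _ = pivot z≤n refl
evenRow-evenColumn {c = c} (suc k) flat pivot
  (x , y , q≤y , y<g , g≤x , s , s⁺) (x′ , y′ , q≤y′ , y′<g , g≤x′ , s′ , s′⁺)
  with a , p ← below⇒sum (≤-trans q≤y (≤-trans (≤-trans (n≤1+n y) (n≤1+n _)) (≤-trans y<g g≤x)))
     | b , p₁ ← below⇒sum q≤y
     | a′ , p′ ← below⇒sum (≤-trans (s≤s q≤y′) (≤-trans (n≤1+n _) (≤-trans y′<g g≤x′)))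
     | b′ , p₁′ ← below⇒sum q≤y′ =
  pivot (≤-trans q≤y (≤-trans (≤-trans (n≤1+n y) (n≤1+n _)) y<g)) (begin
    c (suc k) (suc k) ≡⟨ s′⁺ (suc k) a′ (suc k) b′ p′ (cong suc p₁′) ⟩
    c b′ a′           ≡⟨ s′ (suc k) a′ k b′ p′ p₁′ ⟨
    c k (suc k)       ≡⟨ s⁺ k a (suc k) b p (cong suc p₁) ⟩
    c a b             ≡⟨ s k a k b p p₁ ⟨
    c k k             ≡⟨ flat k ≤-refl ⟩
    c 0 0             ∎)
  where open ≡-Reasoning

-- The bound for a rainbow-free colouring.

below? : ∀ {r} (M N : ℕ) (c : ℕ → ℕ → Fin r) a b → Dec (Below M N c a b)
below? M N c a b = map′
  (λ (x , x≤M , y , y≤N , rest) → x , y , s≤s⁻¹ x≤M , s≤s⁻¹ y≤N , rest)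
  (λ (x , y , x≤M , y≤N , rest) → x , s≤s x≤M , y , s≤s y≤N , rest)
  (anyUpTo? (λ x → anyUpTo? (λ y → symmetric? c x y ×-dec (a ≤? x) ×-dec (b ≤? y)) (suc N)) (suc M))

rainbowFree-bound : ∀ {r} M N (c : ℕ → ℕ → Fin r) → RainbowFree M N c →
                    (∀ k → ∃[ a ] ∃[ b ] (a ≤ M × b ≤ N × c a b ≡ k)) → r ≤ 2 + (N + M)
rainbowFree-bound {r} M N c rf exact
  with greatest (λ t → below? M N c t t) M 0 z≤n
         -- `(0 , 0)` is no sum of cells, hence vacuously symmetric.
         (0 , 0 , z≤n , z≤n , (λ _ _ _ _ ()) , z≤n , z≤n)
... | g , _ , corner , max = bound
  where
  transposeSymmetric : ∀ {c : ℕ → ℕ → Fin r} {x y} → Symmetric c x y → Symmetric (transpose c) y x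
  transposeSymmetric s a a′ b b′ p p′ = s b b′ a a′ p′ p
  transposeBelow : ∀ {M N} {c : ℕ → ℕ → Fin r} {t} → Below M N c t t → Below N M (transpose c) t t
  transposeBelow (x , y , x≤M , y≤N , s , t≤x , t≤y) =
    y , x , y≤N , x≤M , transposeSymmetric s , t≤y , t≤x
  g-max : ∀ t → Below M N c t t → t ≤ g
  g-max t β@(x , _ , x≤M , _ , _ , t≤x , _) = max t (≤-trans t≤x x≤M) β
  combine : ∀ q → (∀ t → t < q → c t t ≡ c 0 0) → (q ≤ g → c q q ≢ c 0 0) → r ≤ 2 + (N + M)
  combine q flat pivot
    -- `g` and `q` concern only main-diagonal cells, so they also serve the transposed colouring.
    with fewOrEven rf g q corner g-max flat pivot exact
       | fewOrEven {c = transpose c} (λ a a′ b b′ p p′ → rf b b′ a a′ p′ p) g q (transposeBelow corner)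
           (λ t → g-max t ∘ transposeBelow) flat pivot
           (λ k → let a , b , a≤M , b≤N , e = exact k in b , a , b≤N , a≤M , e)
  ... | inj₁ few | _ = few
  ... | inj₂ _ | inj₁ few = subst (λ u → r ≤ 2 + u) (+-comm M N) few
  ... | inj₂ even | inj₂ even′ = contradiction even′ (evenRow-evenColumn q flat pivot even)
  bound : r ≤ 2 + (N + M)
  bound with leastBelow (λ t → ¬? (c t t Fin.≟ c 0 0)) (suc g)
  ... | inj₁ (q , _ , ne , least) =
    combine q (λ t t<q → decidable-stable (c t t Fin.≟ c 0 0) (least t t<q)) (λ _ → ne)
  -- If the main diagonal has one colour up to `g`, then `q = suc g` makes the pivot condition
  -- vacuous.
  ... | inj₂ none =
    combine (suc g) (λ t t<q → decidable-stable (c t t Fin.≟ c 0 0) (none t t<q))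
      (λ g<g → contradiction g<g (<-irrefl refl))

-- Upper bound on the grid.

anyCell? : ∀ {m n} {P : Grid m n → Set} → Decidable P → Dec (∃[ p ] P p)
anyCell? P? = map′ (λ (i , j , p) → (i , j) , p) (λ ((i , j) , p) → i , j , p)
  (Fin.any? λ i → Fin.any? λ j → P? (i , j))

rainbow? : ∀ {m n r} (c : Coloring m n r) → Dec (RainbowSolution c)
rainbow? c = anyCell? λ α → anyCell? λ β → anyCell? λ γ →
  ((_ ≟ _) ×-dec (_ ≟ _))
  ×-dec ¬? (c α Fin.≟ c β) ×-dec ¬? (c α Fin.≟ c γ) ×-dec ¬? (c β Fin.≟ c γ)

-- Truncation extends a grid colouring to all pairs of naturals, and in the lower bound merges
-- surplus colours into the last one.
clamp : ∀ M → ℕ → Fin (suc M)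
clamp M a = fromℕ< (s≤s (m⊓n≤n a M))

toℕ-clamp : ∀ {M a} → a ≤ M → toℕ (clamp M a) ≡ a
toℕ-clamp a≤M = trans (Fin.toℕ-fromℕ< _) (m≤n⇒m⊓n≡m a≤M)

clamp-toℕ : ∀ {M} (i : Fin (suc M)) → clamp M (toℕ i) ≡ i
clamp-toℕ i = Fin.toℕ-injective (toℕ-clamp (s≤s⁻¹ (Fin.toℕ<n i)))

clamp-sum : ∀ {M} a a′ → suc (a + a′) ≤ M →
            suc (toℕ (clamp M a)) + suc (toℕ (clamp M a′)) ≡ suc (toℕ (clamp M (suc (a + a′))))
clamp-sum a a′ le
  rewrite toℕ-clamp (≤-trans (m≤n⇒m≤1+n (m≤m+n a a′)) le)
        | toℕ-clamp (≤-trans (m≤n⇒m≤1+n (m≤n+m a′ a)) le)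
        | toℕ-clamp le = cong suc (+-suc a a′)

rainbowForced : ∀ M N → RainbowForced (suc M) (suc N) (suc M + suc N + 1)
-- Existence of a rainbow solution is decidable on a finite grid, so refuting its absence produces
-- one.
rainbowForced M N col exact = decidable-stable (rainbow? col) λ ¬rainbow →
  <-irrefl refl (≤-trans
    (≤-reflexive (solve 2 (λ M N → con 3 :+ (N :+ M) := con 1 :+ M :+ (con 1 :+ N) :+ con 1) refl M N))
    (rainbowFree-bound M N c (rainbowFree ¬rainbow) cells))
  where
  c : ℕ → ℕ → Fin (suc M + suc N + 1)
  c a b = col (clamp M a , clamp N b)
  cells : ∀ k → ∃[ a ] ∃[ b ] (a ≤ M × b ≤ N × c a b ≡ k)
  cells k with (i , j) , e ← exact k =
    toℕ i , toℕ j , s≤s⁻¹ (Fin.toℕ<n i) , s≤s⁻¹ (Fin.toℕ<n j) ,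
    trans (cong₂ (λ i j → col (i , j)) (clamp-toℕ i) (clamp-toℕ j)) e
  rainbowFree : ¬ RainbowSolution col → RainbowFree M N c
  rainbowFree ¬rainbow a a′ b b′ p p′ with c a b Fin.≟ c a′ b′
    | c a b Fin.≟ c (suc (a + a′)) (suc (b + b′)) | c a′ b′ Fin.≟ c (suc (a + a′)) (suc (b + b′))
  ... | yes e | _ | _ = inj₁ e
  ... | no _ | yes e | _ = inj₂ (inj₁ e)
  ... | no _ | no _ | yes e = inj₂ (inj₂ e)
  ... | no n₁ | no n₂ | no n₃ =
    contradiction (_ , _ , _ , (clamp-sum a a′ p , clamp-sum b b′ p′) , n₁ , n₂ , n₃) ¬rainbow

-- Lower bound by the hook colouring.

-- The cells of the last row and column get distinct nonzero colours; none of them is a summand.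
hook : ℕ → ℕ → ℕ → ℕ → ℕ
hook M N a b with a ≟ M | b ≟ N
... | yes _ | _     = suc b
... | no _  | yes _ = 2 + (N + a)
... | no _  | no _  = 0

hook-interior : ∀ {M N a b} → a < M → b < N → hook M N a b ≡ 0
hook-interior {M} {N} {a} {b} a<M b<N with a ≟ M | b ≟ N
... | yes refl | _ = contradiction a<M (<-irrefl refl)
... | no _ | yes refl = contradiction b<N (<-irrefl refl)
... | no _ | no _ = refl

hook-row : ∀ M N b → hook M N M b ≡ suc b
hook-row M N b with M ≟ M
... | yes _ = refl
... | no ne = contradiction refl ne

hook-column : ∀ {M} N {a} → a < M → hook M N a N ≡ 2 + (N + a)
hook-column {M} N {a} a<M with a ≟ M | N ≟ N
... | yes refl | _ = contradiction a<M (<-irrefl refl)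
... | no _ | yes _ = refl
... | no _ | no ne = contradiction refl ne

hook-exact : ∀ M N → 1 ≤ M → 1 ≤ N → ∀ k → k < 2 + (N + M) →
             ∃[ a ] ∃[ b ] (a ≤ M × b ≤ N × hook M N a b ≡ k)
hook-exact M N 1≤M 1≤N zero _ = 0 , 0 , z≤n , z≤n , hook-interior 1≤M 1≤N
hook-exact M N _ _ (suc k) (s≤s k<) with k ≤? N
... | yes k≤N = M , k , ≤-refl , k≤N , hook-row M N k
-- The last row uses colours `1` to `suc N`; beyond them `suc k` is `2 + (N + a)`, found in the last
-- column.
... | no k≰N with a , refl ← below⇒sum (≰⇒> k≰N) =
  a , N , <⇒≤ a<M , ≤-refl , hook-column N a<M
  where
  a<M : a < M
  a<M = +-cancelˡ-< N a M (s≤s⁻¹ k<)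

-- Every number of colours below the maximum is reached by merging colours of the hook colouring.
rainbowAvoided : ∀ M N → 1 ≤ M → 1 ≤ N → ∀ s → suc s ≤ 2 + (N + M) →
                 ∃[ c ] (Exact {suc M} {suc N} {suc s} c × ¬ RainbowSolution c)
rainbowAvoided M N 1≤M 1≤N s s< = col , exact , avoids
  where
  col : Coloring (suc M) (suc N) (suc s)
  col (i , j) = clamp s (hook M N (toℕ i) (toℕ j))
  exact : Exact col
  exact k with a , b , a≤M , b≤N , e ← hook-exact M N 1≤M 1≤N (toℕ k) (≤-trans (Fin.toℕ<n k) s<) =
    (clamp M a , clamp N b) , (begin
      clamp s (hook M N (toℕ (clamp M a)) (toℕ (clamp N b)))
        ≡⟨ cong (clamp s) (cong₂ (hook M N) (toℕ-clamp a≤M) (toℕ-clamp b≤N)) ⟩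
      clamp s (hook M N a b) ≡⟨ cong (clamp s) e ⟩
      clamp s (toℕ k)        ≡⟨ clamp-toℕ k ⟩
      k                      ∎)
    where open ≡-Reasoning
  summand : ∀ {K} (i i′ k : Fin (suc K)) → suc (toℕ i) + suc (toℕ i′) ≡ suc (toℕ k) → toℕ i < K
  summand i i′ k e = ≤-trans (≤-trans (m<m+n (toℕ i) (s≤s z≤n)) (≤-reflexive (suc-injective e)))
    (s≤s⁻¹ (Fin.toℕ<n k))
  avoids : ¬ RainbowSolution col
  avoids ((i , j) , (i′ , j′) , (k , l) , (e , e′) , α≢β , _) = α≢β (cong (clamp s) (trans
    (hook-interior (summand i i′ k e) (summand j j′ l e′))
    (sym (hook-interior (summand i′ i k (trans (+-comm (suc (toℕ i′)) _) e))
                        (summand j′ j l (trans (+-comm (suc (toℕ j′)) _) e′))))))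

theorem5p5 : (m n : ℕ) → 2 ≤ m → m ≤ n → RbEq m n (m + n + 1)
theorem5p5 (suc M) (suc N) (s≤s 1≤M) (s≤s M≤N) =
  s≤s z≤n , rainbowForced M N , λ where
    (suc s) _ s< → rainbowAvoided M N 1≤M (≤-trans 1≤M M≤N) s (s≤s⁻¹ (≤-trans s< (≤-reflexive
      (solve 2 (λ M N → con 1 :+ M :+ (con 1 :+ N) :+ con 1 := con 3 :+ (N :+ M)) refl M N))))
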